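{- An unsatisfiable clause-set $F$ is a total mps if and only if $F \in \mathrm{SMU}_{\delta=1}$.
   Context: Clauses are finite sets of literals without complementary pair; clause-sets are finite sets of clauses; $\top$ is the empty clause-set. $G \models C$ means every satisfying assignment of $G$ satisfies $C$. A clause-set $G$ is a minimal premise set (mps) for a clause $C$ if $G\models C$ and no proper subset of $G$ implies $C$; $G$ is an mps if it is an mps for some clause. A clause-set $F\ne\top$ is a total mps if every nonempty subset of $F$ is an mps. $F$ is minimally unsatisfiable if it is unsatisfiable but $F\setminus\{C\}$ is satisfiable for every $C\in F$; it is saturated minimally unsatisfiable if moreover for every $C\in F$ and every literal $x$ with $\mathrm{var}(x)\notin\mathrm{var}(C)$ the clause-set $(F\setminus\{C\})\cup\{C\cup\{x\}\}$ is satisfiable. The deficiency is $\delta(F) = |F| - |\mathrm{var}(F)|$. $\mathrm{SMU}_{\delta=1}$ is the set of saturated minimally unsatisfiable clause-sets of deficiency $1$. -}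

module Defs where

open import Data.Nat using (ℕ; suc; _<_; _≟_)
open import Data.Bool using (Bool; true; false; not)
open import Data.Product using (_×_; _,_; proj₁; ∃)
open import Data.Fin using (Fin)
open import Data.List using (List; []; _∷_; length; map; concatMap; deduplicate; removeAt; updateAt; lookup)
open import Data.List.Relation.Unary.All using (All)
open import Data.List.Relation.Unary.Any using (Any)
open import Data.List.Relation.Unary.Unique.Propositional using (Unique)
open import Data.List.Relation.Unary.AllPairs using (AllPairs)
open import Data.List.Membership.Propositional using (_∈_; _∉_)
open import Data.List.Relation.Binary.Subset.Propositional using (_⊆_)
import Data.List.Relation.Binary.Sublist.Propositional as Sub
open import Relation.Binary.PropositionalEquality using (_≡_)
open import Relation.Nullary using (¬_)

Var : Set
Var = ℕ

Lit : Set
Lit = Var × Bool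

var : Lit → Var
var = proj₁

-- A clause is represented by a duplicate-free list of literals (a finite set).
Clause : Set
Clause = List Lit

ClauseSet : Set
ClauseSet = List Clause

NoComplementary : Clause → Set
NoComplementary C = ∀ v → ¬ ((v , true) ∈ C × (v , false) ∈ C)

IsClause : Clause → Set
IsClause C = Unique C × NoComplementary C

_≐_ : Clause → Clause → Set
C ≐ D = C ⊆ D × D ⊆ C

IsClauseSet : ClauseSet → Set
IsClauseSet F = All IsClause F × AllPairs (λ C D → ¬ (C ≐ D)) F

vars : ClauseSet → List Var
vars F = deduplicate _≟_ (concatMap (map var) F)

varsC : Clause → List Var
varsC C = map var C

-- deficiency δ(F) = |F| - |var(F)| equals 1
Deficiency1 : ClauseSet → Set
Deficiency1 F = length F ≡ suc (length (vars F))

Assignment : Set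
Assignment = Var → Bool

satLit : Assignment → Lit → Set
satLit φ (v , b) = φ v ≡ b

satClause : Assignment → Clause → Set
satClause φ C = Any (satLit φ) C

satCS : Assignment → ClauseSet → Set
satCS φ F = All (satClause φ) F

Satisfiable : ClauseSet → Set
Satisfiable F = ∃ λ φ → satCS φ F

Unsatisfiable : ClauseSet → Set
Unsatisfiable F = ¬ Satisfiable F

_⊨_ : ClauseSet → Clause → Set
G ⊨ C = ∀ (φ : Assignment) → satCS φ G → satClause φ C

-- subsets of a clause-set are sublists; proper subsets are strictly shorter sublists
-- (equivalent since clause-sets have no repeated clauses)
IsMPSFor : ClauseSet → Clause → Set
IsMPSFor G C = G ⊨ C × (∀ G' → G' Sub.⊆ G → length G' < length G → ¬ (G' ⊨ C))

IsMPS : ClauseSet → Set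
IsMPS G = ∃ λ C → IsClause C × IsMPSFor G C

IsTotalMPS : ClauseSet → Set
IsTotalMPS F = ¬ (F ≡ []) × (∀ G → G Sub.⊆ F → ¬ (G ≡ []) → IsMPS G)

IsMU : ClauseSet → Set
IsMU F = Unsatisfiable F × (∀ (i : Fin (length F)) → Satisfiable (removeAt F i))

IsSMU : ClauseSet → Set
IsSMU F = IsMU F ×
  (∀ (i : Fin (length F)) (x : Lit) → var x ∉ varsC (lookup F i) →
     Satisfiable (updateAt F i (x ∷_)))

IsSMUδ1 : ClauseSet → Set
IsSMUδ1 F = IsSMU F × Deficiency1 F

{-# OPTIONS --safe #-}
module Submission where

-- Total mps ⇒ SMU of deficiency 1. The two-element subsets force any two clauses to clash, so an
-- assignment falsifying one clause satisfies all others; this gives saturation. Any mps G implies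
-- its clause of pure literals, so each further clause must clash with a pure literal of G; hence
-- the number of variables occurring in both signs grows with every clause, and |F| ≤ 1 + |var(F)|.
-- Tarsi's bound |F| ≥ 1 + |var(F)| for minimally unsatisfiable F is proved by splitting on a
-- variable: minimally unsatisfiable subsets of the two restrictions together cover F, and the bound
-- is applied to the second relative to the variables of the first.
--
-- Conversely, restricting a saturated F by any literal leaves it minimally unsatisfiable. Tarsi's
-- bound for these restrictions shows that, in deficiency 1, a variable v with the fewest occurrences
-- lies in just two clauses, and saturation makes these C ∪ {v} and C ∪ {v̄}. Replacing them by C
-- keeps F saturated of deficiency 1; undoing this step preserves both that any two clauses clash
-- and that every nonempty subset implies its clause of pure literals.

open import Defs
open import Level using (0ℓ)
open import Data.Bool using (Bool; true; false; not)
import Data.Bool.Properties as Bool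
open import Data.Empty using (⊥; ⊥-elim)
open import Data.Fin using (zero; suc)
open import Data.List using (List; []; _∷_; _++_; length; map; concat; concatMap; filter; deduplicate; removeAt; updateAt; lookup)
open import Data.List.Extrema.Nat using (argmin; argmin-all; f[argmin]≤f[xs])
open import Data.List.Membership.Propositional using (_∈_; _∉_; find; lose)
open import Data.List.Membership.Propositional.Properties
  using (∈-filter⁺; ∈-filter⁻; ∈-map⁺; ∈-map⁻; ∈-++⁺ˡ; ∈-++⁺ʳ; ∈-++⁻; ∈-concatMap⁺; ∈-concatMap⁻; ∈-concat⁺′; ∈-deduplicate⁺; ∈-deduplicate⁻; ∈-lookup)
open import Data.List.Properties using (filter-all; filter-some; length-filter) renaming (≡-dec to List-≡-dec)
open import Data.List.Relation.Unary.All as All using (All; []; _∷_)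
open import Data.List.Relation.Unary.All.Properties using (¬All⇒Any¬)
open import Data.List.Relation.Unary.AllPairs as AllPairs using (AllPairs; []; _∷_)
open import Data.List.Relation.Unary.Any as Any using (Any; here; there; any?)
open import Data.List.Relation.Unary.Any.Properties using (lookup-index)
open import Data.List.Relation.Unary.Unique.Propositional using (Unique)
open import Data.List.Relation.Unary.Unique.DecPropositional.Properties using (deduplicate-!; filter⁺)
import Data.List.Relation.Binary.Sublist.Propositional as Sub
open import Data.List.Relation.Binary.Sublist.Propositional.Properties using (All-resp-⊆)
open import Data.Nat using (ℕ; zero; suc; _+_; _≤_; _<_; z≤n; s≤s; _≟_)
open import Data.Nat.Properties
open import Data.Product using (_×_; _,_; proj₁; proj₂; ∃)
import Data.Product.Properties as Product
open import Data.Sum using (_⊎_; inj₁; inj₂; [_,_]′)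
open import Function using (_∘_; id; case_of_)
open import Relation.Binary.Definitions using (DecidableEquality)
open import Relation.Binary.PropositionalEquality using (_≡_; _≢_; refl; sym; trans; cong; subst)
open import Relation.Nullary using (¬_; Dec; yes; no; ¬?; _×-dec_; _⊎-dec_)
open import Relation.Nullary.Decidable using (map′; decidable-stable)
open import Relation.Unary using (Pred; Decidable)

-- Counting list entries by decidable predicates.

count : {A : Set} {P : Pred A 0ℓ} → Decidable P → List A → ℕ
count P? xs = length (filter P? xs)

count-cover : {A : Set} {P Q R : Pred A 0ℓ} (P? : Decidable P) (Q? : Decidable Q) (R? : Decidable R) →
  (∀ {x} → P x → Q x ⊎ R x) → ∀ xs → count P? xs ≤ count Q? xs + count R? xs
count-cover P? Q? R? f []       = z≤n
count-cover P? Q? R? f (x ∷ xs) with ih ← count-cover P? Q? R? f xs | P? x | Q? x | R? x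
... | no _   | no _   | no _   = ih
... | no _   | yes _  | no _   = m≤n⇒m≤1+n ih
... | no _   | no _   | yes _  = ≤-trans ih (+-monoʳ-≤ _ (n≤1+n _))
... | no _   | yes _  | yes _  = m≤n⇒m≤1+n (≤-trans ih (+-monoʳ-≤ _ (n≤1+n _)))
... | yes p  | no ¬q  | no ¬r  = ⊥-elim ([ ¬q , ¬r ]′ (f p))
... | yes _  | yes _  | no _   = s≤s ih
... | yes _  | no _   | yes _  = ≤-trans (s≤s ih) (≤-reflexive (sym (+-suc _ _)))
... | yes _  | yes _  | yes _  = s≤s (≤-trans ih (+-monoʳ-≤ _ (n≤1+n _)))

count-disjoint : {A : Set} {P Q R : Pred A 0ℓ} (P? : Decidable P) (Q? : Decidable Q) (R? : Decidable R) →
  (∀ {x} → Q x → P x) → (∀ {x} → R x → P x) → (∀ {x} → Q x → ¬ R x) →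
  ∀ xs → count Q? xs + count R? xs ≤ count P? xs
count-disjoint P? Q? R? f g h []       = z≤n
count-disjoint P? Q? R? f g h (x ∷ xs) with ih ← count-disjoint P? Q? R? f g h xs | P? x | Q? x | R? x
... | _      | yes q  | yes r  = ⊥-elim (h q r)
... | no ¬p  | yes q  | no _   = ⊥-elim (¬p (f q))
... | no ¬p  | no _   | yes r  = ⊥-elim (¬p (g r))
... | no _   | no _   | no _   = ih
... | yes _  | no _   | no _   = m≤n⇒m≤1+n ih
... | yes _  | yes _  | no _   = s≤s ih
... | yes _  | no _   | yes _  = ≤-trans (≤-reflexive (+-suc _ _)) (s≤s ih)

count-mono : {A : Set} {P Q : Pred A 0ℓ} (P? : Decidable P) (Q? : Decidable Q) → (∀ {x} → Q x → P x) →
  ∀ xs → count Q? xs ≤ count P? xs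
count-mono P? Q? f xs =
  ≤-trans (m≤m+n _ _) (count-disjoint {R = λ _ → ⊥} P? Q? (λ _ → no λ ()) f (λ ()) (λ _ ()) xs)

count-pos : {A : Set} {P : Pred A 0ℓ} (P? : Decidable P) → ∀ {x xs} → x ∈ xs → P x → 1 ≤ count P? xs
count-pos P? x∈xs p = filter-some P? (lose x∈xs p)

count-∃ : {A : Set} {P : Pred A 0ℓ} (P? : Decidable P) → ∀ xs → 1 ≤ count P? xs → ∃ λ x → x ∈ xs × P x
count-∃ P? xs le with filter P? xs in eq
... | y ∷ ys = y , ∈-filter⁻ P? (subst (y ∈_) (sym eq) (here refl))

module _ {A : Set} (_≟ᴬ_ : DecidableEquality A) where

  count-≡ : ∀ y {xs} → Unique xs → count (_≟ᴬ y) xs ≤ 1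
  count-≡ y {[]}     _        = z≤n
  count-≡ y {x ∷ xs} (x∉ ∷ u) with x ≟ᴬ y
  ... | no _     = count-≡ y u
  ... | yes refl = s≤s (≤-trans (≮⇒≥ (λ lt →
        let z , z∈ , z≡y = count-∃ (_≟ᴬ y) xs lt in All.lookup x∉ z∈ (sym z≡y))) z≤n)

  count-≥2 : {P : Pred A 0ℓ} (P? : Decidable P) → ∀ {x y xs} → x ∈ xs → y ∈ xs → P x → P y → x ≢ y → 2 ≤ count P? xs
  count-≥2 P? {x} {y} {xs} x∈ y∈ px py x≢y = ≤-trans
    (+-mono-≤ (count-pos (_≟ᴬ x) x∈ refl) (count-pos (_≟ᴬ y) y∈ refl))
    (count-disjoint P? (_≟ᴬ x) (_≟ᴬ y) (λ { refl → px }) (λ { refl → py }) (λ { refl → x≢y }) xs)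

minimal : {A : Set} (f : A → ℕ) → ∀ {x} xs → x ∈ xs → ∃ λ m → m ∈ xs × (∀ {y} → y ∈ xs → f m ≤ f y)
minimal f {x} xs x∈ = argmin f x xs , argmin-all f x∈ (All.tabulate id) , All.lookup (f[argmin]≤f[xs] x xs)

-- Literals, and changing an assignment at one literal.

_≟ᴸ_ : DecidableEquality Lit
_≟ᴸ_ = Product.≡-dec _≟_ Bool._≟_

_≟ᶜ_ : DecidableEquality Clause
_≟ᶜ_ = List-≡-dec _≟ᴸ_

open import Data.List.Membership.DecPropositional _≟_ using () renaming (_∈?_ to _∈ⱽ?_)
open import Data.List.Membership.DecPropositional _≟ᴸ_ using () renaming (_∈?_ to _∈ᴸ?_)
open import Data.List.Membership.DecPropositional _≟ᶜ_ using () renaming (_∈?_ to _∈ᶜ?_)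

neg : Lit → Lit
neg (v , b) = v , not b

neg-involutive : ∀ x → neg (neg x) ≡ x
neg-involutive (v , b) = cong (v ,_) (Bool.not-involutive b)

satLit? : ∀ φ → Decidable (satLit φ)
satLit? φ (v , b) = φ v Bool.≟ b

satClause? : ∀ φ → Decidable (satClause φ)
satClause? φ = any? (satLit? φ)

satCS? : ∀ φ → Decidable (satCS φ)
satCS? φ = All.all? (satClause? φ)

satLit-neg : ∀ φ x → satLit φ x → ¬ satLit φ (neg x)
satLit-neg φ (v , true)  p q = case trans (sym p) q of λ ()
satLit-neg φ (v , false) p q = case trans (sym p) q of λ ()

¬satLit⇒neg : ∀ φ x → ¬ satLit φ x → satLit φ (neg x)
¬satLit⇒neg φ (v , b) ¬p = Bool.¬-not ¬p

set : Assignment → Lit → Assignment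
set φ (v , b) w with w ≟ v
... | yes _ = b
... | no _  = φ w

set-self : ∀ φ x → satLit (set φ x) x
set-self φ (v , b) with v ≟ v
... | yes _ = refl
... | no ¬p = ⊥-elim (¬p refl)

set-keep : ∀ φ x {y} → satLit φ y → y ≢ neg x → satLit (set φ x) y
set-keep φ (v , b) {w , c} p y≢ with w ≟ v
... | no _     = p
... | yes refl = trans (sym (Bool.not-involutive b)) (sym (Bool.¬-not (λ c≡ → y≢ (cong (v ,_) c≡))))

set-only : ∀ φ x {y} → satLit (set φ x) y → y ≢ x → satLit φ y
set-only φ (v , b) {w , c} p y≢ with w ≟ v
... | no _     = p
... | yes refl = ⊥-elim (y≢ (cong (v ,_) (sym p)))

∈∉⇒≢ : ∀ {A : Set} {x y : A} {xs} → x ∈ xs → y ∉ xs → x ≢ y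
∈∉⇒≢ x∈ y∉ refl = y∉ x∈

set-keep-clause : ∀ φ x {E} → satClause φ E → neg x ∉ E → satClause (set φ x) E
set-keep-clause φ x sat ¬x∉ =
  let y , y∈ , p = find sat in lose y∈ (set-keep φ x p (∈∉⇒≢ y∈ ¬x∉))

set-only-clause : ∀ φ x {E} → satClause (set φ x) E → x ∉ E → satClause φ E
set-only-clause φ x sat x∉ =
  let y , y∈ , p = find sat in lose y∈ (set-only φ x p (∈∉⇒≢ y∈ x∉))

∈-varsC : ∀ {x E} → x ∈ E → var x ∈ varsC E
∈-varsC = ∈-map⁺ var

varsC-∈ : ∀ {v E} → v ∈ varsC E → ∃ λ b → (v , b) ∈ E
varsC-∈ v∈ with (_ , b) , x∈ , refl ← ∈-map⁻ var v∈ = b , x∈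

neg-∈ : ∀ {x E} → var x ∈ varsC E → x ∉ E → neg x ∈ E
neg-∈ {_ , b} v∈ x∉ with b | varsC-∈ v∈
... | true  | true  , x∈  = ⊥-elim (x∉ x∈)
... | true  | false , ¬x∈ = ¬x∈
... | false | true  , ¬x∈ = ¬x∈
... | false | false , x∈  = ⊥-elim (x∉ x∈)

-- Finite search for assignments.

allVars : ClauseSet → List Var
allVars = concatMap varsC

∈-allVars : ∀ {v E S} → E ∈ S → v ∈ varsC E → v ∈ allVars S
∈-allVars E∈ v∈ = ∈-concatMap⁺ varsC (lose E∈ v∈)

AgreeOn : List Var → Assignment → Assignment → Set
AgreeOn Vs φ ψ = ∀ {v} → v ∈ Vs → φ v ≡ ψ v

-- Only the values on `Vs` matter to `P`, so fixing them one variable at a time leaves finitely many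
-- cases. This makes case distinctions on satisfiability constructive.
search : ∀ Vs {P : Pred Assignment 0ℓ} → Decidable P →
  (∀ {φ ψ} → AgreeOn Vs φ ψ → P φ → P ψ) → Dec (∃ P)
search [] P? ext = map′ (_ ,_) (λ (_ , p) → ext (λ ()) p) (P? (λ _ → true))
search (v ∷ Vs) {P} P? ext =
  map′ [ (λ (_ , p) → _ , p) , (λ (_ , p) → _ , p) ]′ split (branch true ⊎-dec branch false)
  where
  branch : ∀ b → Dec (∃ λ φ → P (set φ (v , b)))
  branch b = search Vs (λ φ → P? (set φ (v , b))) (λ agree → ext (agree-set agree))
    where
    agree-set : ∀ {φ ψ} → AgreeOn Vs φ ψ → AgreeOn (v ∷ Vs) (set φ (v , b)) (set ψ (v , b))
    agree-set agree {w} w∈ with w ≟ v | w∈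
    ... | yes _ | _        = refl
    ... | no ≢v | here ≡v  = ⊥-elim (≢v ≡v)
    ... | no _  | there w∈ = agree w∈

  set-id : ∀ φ {w} → φ w ≡ set φ (v , φ v) w
  set-id φ {w} with w ≟ v
  ... | yes refl = refl
  ... | no _     = refl

  split : ∃ P → (∃ λ φ → P (set φ (v , true))) ⊎ (∃ λ φ → P (set φ (v , false)))
  split (φ , p) with φ v | ext (λ _ → set-id φ) p
  ... | true  | q = inj₁ (φ , q)
  ... | false | q = inj₂ (φ , q)

-- Minimal unsatisfiability and saturation under a partial assignment.

Ext : List Lit → Assignment → Set
Ext U φ = All (satLit φ) U

UnsatUnder : List Lit → ClauseSet → Set
UnsatUnder U S = ∀ φ → Ext U φ → ¬ satCS φ S

satUnder? : ∀ U S → Dec (∃ λ φ → Ext U φ × satCS φ S)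
satUnder? U S = search (map var U ++ allVars S)
  (λ φ → All.all? (satLit? φ) U ×-dec satCS? φ S)
  (λ agree (e , s) →
    All.tabulate (λ x∈ → trans (sym (agree (∈-++⁺ˡ (∈-map⁺ var x∈)))) (All.lookup e x∈)) ,
    All.tabulate (λ E∈ → let y , y∈ , p = find (All.lookup s E∈) in
      lose y∈ (trans (sym (agree (∈-++⁺ʳ (map var U) (∈-allVars E∈ (∈-varsC y∈))))) p)))

-- The other clauses are singled out by inequality, not by deleting a position, so the notion passes
-- to subsets and tolerates repetitions in `S`.
record Separates (U : List Lit) (S : ClauseSet) (E : Clause) (φ : Assignment) : Set where
  field
    ext       : Ext U φ
    others    : ∀ {E′} → E′ ∈ S → E′ ≢ E → satClause φ E′
    falsifies : ¬ satClause φ E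

separates-⊆ : ∀ {U S S′ E φ} → (∀ {E′} → E′ ∈ S′ → E′ ∈ S) → Separates U S E φ → Separates U S′ E φ
separates-⊆ S′⊆S sep = record
  { ext = Separates.ext sep ; others = Separates.others sep ∘ S′⊆S ; falsifies = Separates.falsifies sep }

separates-∷ : ∀ {U S E φ x} → satLit φ x → Separates U S E φ → Separates (x ∷ U) S E φ
separates-∷ px sep = record
  { ext = px ∷ Separates.ext sep ; others = Separates.others sep ; falsifies = Separates.falsifies sep }

-- Restrictions of clause-sets are never formed: S stands for its restriction by the partial
-- assignment that makes the literals of U true.
record Critical (U : List Lit) (S : ClauseSet) : Set where
  field
    unsat    : UnsatUnder U S
    separate : ∀ {E} → E ∈ S → ∃ (Separates U S E)

-- Satisfiability after adding `x` to `E` is expressed by an assignment that falsifies `E`,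
-- satisfies the other clauses and makes `x` true.
record Saturated (U : List Lit) (S : ClauseSet) : Set where
  field
    critical : Critical U S
    saturate : ∀ {E x} → E ∈ S → x ∉ E → var x ∉ map var U → ∃ λ φ → Separates U S E φ × satLit φ x
  open Critical critical public

unsat⇒falsifies : ∀ {U S E φ} → UnsatUnder U S → Ext U φ →
  (∀ {E′} → E′ ∈ S → E′ ≢ E → satClause φ E′) → ¬ satClause φ E
unsat⇒falsifies {E = E} unsat ext others sat = unsat _ ext (All.tabulate λ {E′} E′∈ → case E′ ≟ᶜ E of λ
  { (yes refl) → sat ; (no ≢) → others E′∈ ≢ })

ext-set : ∀ {U φ} x → var x ∉ map var U → Ext U φ → Ext U (set φ x)
ext-set {φ = φ} x x∉ ext = All.tabulate λ y∈ →
  set-keep φ x (All.lookup ext y∈) λ { refl → x∉ (∈-map⁺ var y∈) }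

-- No assignment extending `U` could falsify a clause containing a literal of `U`.
critical-∌ : ∀ {U S E x} → Critical U S → x ∈ U → E ∈ S → x ∉ E
critical-∌ crit x∈U E∈ x∈E =
  let φ , sep = Critical.separate crit E∈ in
  Separates.falsifies sep (lose x∈E (All.lookup (Separates.ext sep) x∈U))

-- If no clause of `S₀` contained the variable of `x`, an assignment separating `E`, changed to make
-- `x` true, would satisfy `S₀`. Hence a split variable remains present in each branch.
critical-occurs : ∀ {U S S₀ E x} → Critical U S → UnsatUnder (x ∷ U) S₀ → (∀ {E} → E ∈ S₀ → E ∈ S) →
  var x ∉ map var U → E ∈ S → var x ∈ varsC E → ∃ λ E₀ → E₀ ∈ S₀ × var x ∈ varsC E₀
critical-occurs {S₀ = S₀} {x = x} crit unsat₀ S₀⊆S x∉U E∈ v∈E with any? (λ E₀ → var x ∈ⱽ? varsC E₀) S₀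
... | yes occurs = find occurs
... | no ¬occurs = ⊥-elim (unsat₀ (set φ x) (set-self φ x ∷ ext-set x x∉U ext) (All.tabulate λ E₀∈ →
        set-keep-clause φ x (others (S₀⊆S E₀∈) λ { refl → ¬occurs (lose E₀∈ v∈E) })
          (λ ¬x∈ → ¬occurs (lose E₀∈ (∈-varsC ¬x∈)))))
  where
  φ = proj₁ (Critical.separate crit E∈)
  open Separates (proj₂ (Critical.separate crit E∈))

critical-subset : ∀ U S → UnsatUnder U S → ∃ λ S₀ → Critical U S₀ × (∀ {E} → E ∈ S₀ → E ∈ S)
critical-subset U S unsat =
  let S₀ , crit , sub = go S [] (λ φ e s → unsat φ e (All.tabulate λ E∈ → All.lookup s (∈-++⁺ˡ E∈))) λ ()
  in S₀ , crit , λ E∈ → [ id , (λ ()) ]′ (∈-++⁻ S (sub E∈))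
  where
  -- `R` holds the clauses still to be tested, `K` those found necessary. A clause is dropped if the
  -- rest is unsatisfiable under `U`; otherwise a model of the rest separates it.
  go : ∀ R K → UnsatUnder U (R ++ K) → (∀ {E} → E ∈ K → ∃ (Separates U (R ++ K) E)) →
    ∃ λ S₀ → Critical U S₀ × (∀ {E} → E ∈ S₀ → E ∈ R ++ K)
  go [] K unsat sep = K , record { unsat = unsat ; separate = sep } , id
  go (C ∷ R) K unsat sep with satUnder? U (R ++ K)
  ... | no ¬sat =
    let S₀ , crit , sub = go R K (λ φ e s → ¬sat (φ , e , s)) (λ E∈ →
          let φ , s = sep E∈ in φ , separates-⊆ there s)
    in S₀ , crit , there ∘ sub
  ... | yes (φ , e , s) =
    let S₀ , crit , sub = go R (C ∷ K) unsat′ (λ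
          { (here refl) → φ , record
              { ext       = e
              ; others    = λ E∈ E≢ → case shift E∈ of λ
                  { (here E≡) → ⊥-elim (E≢ E≡) ; (there E∈) → All.lookup s E∈ }
              ; falsifies = λ sat → unsat φ e (sat ∷ s) }
          ; (there E∈) →
              let φ , s = sep E∈ in φ , separates-⊆ shift s })
    in S₀ , crit , shift ∘ sub
    where
    shift : ∀ {E} → E ∈ R ++ C ∷ K → E ∈ C ∷ R ++ K
    shift E∈ with ∈-++⁻ R E∈
    ... | inj₁ E∈R         = there (∈-++⁺ˡ E∈R)
    ... | inj₂ (here E≡)   = here E≡
    ... | inj₂ (there E∈K) = there (∈-++⁺ʳ R E∈K)

    unsat′ : UnsatUnder U (R ++ C ∷ K)
    unsat′ φ e s = unsat φ e
      (All.lookup s (∈-++⁺ʳ R (here refl)) ∷ All.tabulate λ E∈ →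
        All.lookup s ([ ∈-++⁺ˡ , ∈-++⁺ʳ R ∘ there ]′ (∈-++⁻ R E∈)))

-- Tarsi's bound relative to a set of variables.

Outside : List Var → Clause → Set
Outside W E = Any (_∉ W) (varsC E)

outside? : ∀ W → Decidable (Outside W)
outside? W E = any? (λ w → ¬? (w ∈ⱽ? W)) (varsC E)

NewVar : ClauseSet → List Var → Var → Set
NewVar S W w = w ∉ W × Any (λ E → w ∈ varsC E) S

newVar? : ∀ S W → Decidable (NewVar S W)
newVar? S W w = ¬? (w ∈ⱽ? W) ×-dec any? (λ E → w ∈ⱽ? varsC E) S

-- Clauses are counted along a fixed list `F` and variables along a fixed list `Vs`, so counts for
-- different `S` are comparable however `S` is listed.
outside-count : ClauseSet → ClauseSet → List Var → ℕ
outside-count F S W = count (λ E → (E ∈ᶜ? S) ×-dec outside? W E) F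

newVar-count : List Var → ClauseSet → List Var → ℕ
newVar-count Vs S W = count (newVar? S W) Vs

size : ClauseSet → ClauseSet → ℕ
size F S = count (_∈ᶜ? S) F

occurrences : ClauseSet → ClauseSet → Var → ℕ
occurrences F S w = count (λ E → (E ∈ᶜ? S) ×-dec (w ∈ⱽ? varsC E)) F

module _ (F : ClauseSet) (Vs : List Var) (Vs! : Unique Vs) where

  -- Clauses inside `W` are left out so that they can be counted elsewhere. Without new variables no
  -- clause lies outside `W` and the surplus of one fails, hence the alternative. The recursion on
  -- `n` works because each branch loses the split variable `v`.
  newVar-bound : ∀ n {U S W} → newVar-count Vs S W < n → (∀ {E} → E ∈ S → E ∈ F) →
    (∀ {v} → v ∈ map var U → v ∈ W) → Critical U S →
    newVar-count Vs S W ≡ 0 ⊎ suc (newVar-count Vs S W) ≤ outside-count F S W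
  newVar-bound (suc n) {U} {S} {W} (s≤s lt) S⊆F U⊆W crit with newVar-count Vs S W ≟ 0
  ... | yes ≡0 = inj₁ ≡0
  ... | no ≢0 = inj₂ bound
    where
    open Critical crit
    new = count-∃ (newVar? S W) Vs (n≢0⇒n>0 ≢0)
    v = proj₁ new
    v∈Vs = proj₁ (proj₂ new)
    v∉W = proj₁ (proj₂ (proj₂ new))
    E₀ = proj₁ (find (proj₂ (proj₂ (proj₂ new))))
    E₀∈S = proj₁ (proj₂ (find (proj₂ (proj₂ (proj₂ new)))))
    v∈E₀ = proj₂ (proj₂ (find (proj₂ (proj₂ (proj₂ new)))))

    module Branch (b : Bool) where
      subset = critical-subset ((v , b) ∷ U) S (λ { φ (_ ∷ e) s → unsat φ e s })
      T = proj₁ subset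
      crit-T = proj₁ (proj₂ subset)
      T⊆S = proj₂ (proj₂ subset)
      occurs = critical-occurs crit (Critical.unsat crit-T) T⊆S (v∉W ∘ U⊆W) E₀∈S v∈E₀

      bound-by : ∀ {W′} {P : Pred Clause 0ℓ} (P? : Decidable P) → v ∈ W′ → (∀ {w} → w ∈ W → w ∈ W′) →
        (∀ {E} → E ∈ T → Outside W′ E ⊎ v ∈ varsC E → P E) →
        suc (newVar-count Vs T W′) ≤ count P? F
      bound-by {W′} P? v∈W′ W⊆W′ imp
        with newVar-bound n {(v , b) ∷ U} {T} {W′} smaller (S⊆F ∘ T⊆S)
               (λ { (here refl) → v∈W′ ; (there u∈) → W⊆W′ (U⊆W u∈) }) crit-T
        where
        smaller : newVar-count Vs T W′ < n
        smaller = ≤-trans (≤-trans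
          (≤-trans (≤-reflexive (+-comm 1 _)) (+-monoʳ-≤ _ (count-pos (_≟ v) v∈Vs refl)))
          (count-disjoint (newVar? S W) (newVar? T W′) (_≟ v)
            (λ (w∉ , w∈) → w∉ ∘ W⊆W′ , let E , E∈ , w∈E = find w∈ in lose (T⊆S E∈) w∈E)
            (λ { refl → v∉W , lose E₀∈S v∈E₀ }) (λ { (w∉ , _) refl → w∉ v∈W′ }) Vs)) lt
      ... | inj₁ ≡0 rewrite ≡0 =
        let E , E∈ , v∈E = occurs in count-pos P? (S⊆F (T⊆S E∈)) (imp E∈ (inj₂ v∈E))
      ... | inj₂ le = ≤-trans le (count-mono P? _ (λ (E∈ , out) → imp E∈ (inj₁ out)) F)

    module B₀ = Branch true
    module B₁ = Branch false

    -- Treating the variables of the first subset as old in the second branch prevents a clause of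
    -- both subsets from being counted twice.
    W₀ W₁ : List Var
    W₀ = v ∷ W
    W₁ = v ∷ W ++ allVars B₀.T

    Q₀? = λ E → (E ∈ᶜ? B₀.T) ×-dec outside? W E
    Q₁? = λ E → (E ∈ᶜ? B₁.T) ×-dec (outside? W₁ E ⊎-dec (v ∈ⱽ? varsC E))

    outside-mono : ∀ {W W′ E} → (∀ {w} → w ∈ W → w ∈ W′) → Outside W′ E → Outside W E
    outside-mono W⊆W′ = Any.map (_∘ W⊆W′)

    bound₀ : suc (newVar-count Vs B₀.T W₀) ≤ count Q₀? F
    bound₀ = B₀.bound-by Q₀? (here refl) there λ E∈ → λ
      { (inj₁ out) → E∈ , outside-mono there out ; (inj₂ v∈E) → E∈ , lose v∈E v∉W }

    bound₁ : suc (newVar-count Vs B₁.T W₁) ≤ count Q₁? F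
    bound₁ = B₁.bound-by Q₁? (here refl) (there ∘ ∈-++⁺ˡ) _,_

    not-both : ∀ {E} → E ∈ B₀.T × Outside W E → ¬ (E ∈ B₁.T × (Outside W₁ E ⊎ v ∈ varsC E))
    not-both (E∈₀ , _) (_ , inj₁ out) =
      let w , w∈ , w∉ = find out in w∉ (there (∈-++⁺ʳ W (∈-allVars E∈₀ w∈)))
    -- A clause with a literal over `v` is satisfied in one of the branches, so it cannot belong to
    -- the critical subset chosen there.
    not-both (E∈₀ , _) (E∈₁ , inj₂ v∈) with varsC-∈ v∈
    ... | true  , x∈ = critical-∌ B₀.crit-T (here refl) E∈₀ x∈
    ... | false , x∈ = critical-∌ B₁.crit-T (here refl) E∈₁ x∈

    -- If `E` lay in neither subset, an assignment separating `E` would satisfy the subset that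
    -- matches its value at `v`.
    union : ∀ {E} → E ∈ S → E ∉ B₀.T → E ∈ B₁.T
    union {E} E∈ E∉₀ with E ∈ᶜ? B₁.T
    ... | yes E∈₁ = E∈₁
    ... | no E∉₁ with separate E∈
    ...   | φ , sep with φ v in φv
    ...     | true  = ⊥-elim (Critical.unsat B₀.crit-T φ (φv ∷ Separates.ext sep)
                  (All.tabulate λ E′∈ → Separates.others sep (B₀.T⊆S E′∈) (∈∉⇒≢ E′∈ E∉₀)))
    ...     | false = ⊥-elim (Critical.unsat B₁.crit-T φ (φv ∷ Separates.ext sep)
                  (All.tabulate λ E′∈ → Separates.others sep (B₁.T⊆S E′∈) (∈∉⇒≢ E′∈ E∉₁)))

    cover : ∀ {w} → NewVar S W w → w ≡ v ⊎ (NewVar B₀.T W₀ w ⊎ NewVar B₁.T W₁ w)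
    cover {w} (w∉W , w∈S) with w ≟ v | w ∈ⱽ? allVars B₀.T
    ... | yes w≡v | _ = inj₁ w≡v
    ... | no w≢v  | yes w∈₀ =
      inj₂ (inj₁ ((λ { (here e) → w≢v e ; (there w∈) → w∉W w∈ }) , ∈-concatMap⁻ varsC w∈₀))
    ... | no w≢v  | no w∉₀ = let E , E∈ , w∈E = find w∈S in
      inj₂ (inj₂ ( (λ { (here e) → w≢v e ; (there w∈) → [ w∉W , w∉₀ ]′ (∈-++⁻ W w∈) })
                 , lose (union E∈ (λ E∈₀ → w∉₀ (∈-allVars E∈₀ w∈E))) w∈E))

    bound : suc (newVar-count Vs S W) ≤ outside-count F S W
    bound = begin
      suc (newVar-count Vs S W)
        ≤⟨ s≤s (count-cover (newVar? S W) (_≟ v) N? cover Vs) ⟩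
      suc (count (_≟ v) Vs + count N? Vs)
        ≤⟨ s≤s (+-mono-≤ (count-≡ _≟_ v Vs!) (count-cover N? (newVar? B₀.T W₀) (newVar? B₁.T W₁) id Vs)) ⟩
      -- One unit accounts for `v`, the other is the surplus of the bound; each branch supplies one
      -- of them.
      suc (suc (newVar-count Vs B₀.T W₀ + newVar-count Vs B₁.T W₁))
        ≡⟨ cong suc (sym (+-suc _ _)) ⟩
      suc (newVar-count Vs B₀.T W₀) + suc (newVar-count Vs B₁.T W₁)
        ≤⟨ +-mono-≤ bound₀ bound₁ ⟩
      count Q₀? F + count Q₁? F
        ≤⟨ count-disjoint _ Q₀? Q₁? (λ (E∈ , out) → B₀.T⊆S E∈ , out)
             (λ { (E∈ , inj₁ out) → B₁.T⊆S E∈ , outside-mono (there ∘ ∈-++⁺ˡ) out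
                ; (E∈ , inj₂ v∈) → B₁.T⊆S E∈ , lose v∈ v∉W }) not-both F ⟩
      outside-count F S W ∎
      where
      open ≤-Reasoning
      N? = λ w → newVar? B₀.T W₀ w ⊎-dec newVar? B₁.T W₁ w

  size-bound : ∀ {U S E} → Critical U S → (∀ {E} → E ∈ S → E ∈ F) → E ∈ S →
    suc (newVar-count Vs S (map var U)) ≤ size F S
  size-bound {U} {S} crit S⊆F E∈ with newVar-bound (suc _) {U} {S} ≤-refl S⊆F id crit
  ... | inj₁ ≡0 rewrite ≡0 = count-pos (_∈ᶜ? S) (S⊆F E∈) E∈
  ... | inj₂ le = ≤-trans le (count-mono (_∈ᶜ? S) _ proj₁ F)

-- Restrictions of saturated clause-sets and variables with fewest occurrences.

without : Lit → ClauseSet → ClauseSet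
without x = filter (λ E → ¬? (x ∈ᴸ? E))

∈-without⁺ : ∀ {x E S} → E ∈ S → x ∉ E → E ∈ without x S
∈-without⁺ = ∈-filter⁺ _

∈-without⁻ : ∀ x {E S} → E ∈ without x S → E ∈ S × x ∉ E
∈-without⁻ x {S = S} = ∈-filter⁻ (λ E → ¬? (x ∈ᴸ? E)) {xs = S}

without-unsat : ∀ {U S} x → UnsatUnder U S → UnsatUnder (x ∷ U) (without x S)
without-unsat {S = S} x unsat φ (px ∷ e) s = unsat φ e (All.tabulate λ {E} E∈ → case x ∈ᴸ? E of λ
  { (yes x∈) → lose x∈ px ; (no x∉) → All.lookup s (∈-without⁺ E∈ x∉) })

-- Saturation provides a separating assignment for `E` that also makes `x` true, so it remains
-- available under `x ∷ U`.
saturated-without-critical : ∀ {U S} x → Saturated U S → var x ∉ map var U → Critical (x ∷ U) (without x S)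
saturated-without-critical {S = S} x sat x∉U = record
  { unsat    = without-unsat x (Saturated.unsat sat)
  ; separate = λ E∈ →
      let E∈S , x∉E = ∈-without⁻ x {S = S} E∈
          φ , sep , px = Saturated.saturate sat E∈S x∉E x∉U
      in φ , separates-∷ px (separates-⊆ (proj₁ ∘ ∈-without⁻ x {S = S}) sep) }

module _ (F : ClauseSet) (Vs : List Var) (Vs! : Unique Vs) where

  -- If (v , b) occurred twice, the bound on the size of the restriction by (v , b) would leave a
  -- variable w all of whose occurrences lie in clauses with (v , b): fewer than those of v.
  module _ {U S} (sat : Saturated U S) (S⊆F : ∀ {E} → E ∈ S → E ∈ F)
    (def : size F S ≡ suc (newVar-count Vs S (map var U)))
    {v} (v∉U : v ∉ map var U) (v∈S : Any (λ E → v ∈ varsC E) S)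
    (v-min : ∀ {w} → w ∈ Vs → NewVar S (map var U) w → occurrences F S v ≤ occurrences F S w) where

    private
      module Restriction (b : Bool) where
        S′ = without (v , b) S
        crit′ = saturated-without-critical (v , b) sat v∉U

        opposite : ∃ λ E → E ∈ S × (v , b) ∉ E × v ∈ varsC E
        opposite =
          let E , E∈ , v∈E = find v∈S
              E₀ , E₀∈ , v∈E₀ = critical-occurs (Saturated.critical sat) (Critical.unsat crit′)
                (proj₁ ∘ ∈-without⁻ (v , b) {S = S}) v∉U E∈ v∈E
              E₀∈S , x∉E₀ = ∈-without⁻ (v , b) {S = S} E₀∈
          in E₀ , E₀∈S , x∉E₀ , v∈E₀

    negative-occurs : ∀ b → ∃ λ E → E ∈ S × (v , not b) ∈ E
    negative-occurs b = let E , E∈ , x∉E , v∈E = Restriction.opposite b in E , E∈ , neg-∈ v∈E x∉E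

    occurs-once : ∀ b {E E′} → E ∈ S → E′ ∈ S → (v , b) ∈ E → (v , b) ∈ E′ → E ≡ E′
    occurs-once b {E} {E′} E∈ E′∈ x∈E x∈E′ = decidable-stable (E ≟ᶜ E′) λ E≢E′ →
      let w , w∈Vs , (w∉U , w∈S) , w≢v , ¬w-new = count-∃ T? Vs (remaining E≢E′)
          in-S′ : ∀ {D} → D ∈ S → w ∈ varsC D → (v , b) ∈ D
          in-S′ D∈ w∈D = decidable-stable (_ ∈ᴸ? _) λ x∉D →
            ¬w-new ((λ { (here e) → w≢v e ; (there w∈U) → w∉U w∈U }) , lose (∈-without⁺ D∈ x∉D) w∈D)
          -- This clause contains `v` but not `w`, which makes the occurrences of `w` strictly
          -- fewer.
          D , D∈ , x∉D , v∈D = opposite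
          fewer = ≤-trans
            (≤-trans (≤-reflexive (+-comm 1 _)) (+-monoʳ-≤ _ (count-pos (_≟ᶜ D) (S⊆F D∈) refl)))
            (count-disjoint (λ E → (E ∈ᶜ? S) ×-dec (v ∈ⱽ? varsC E)) (λ E → (E ∈ᶜ? S) ×-dec (w ∈ⱽ? varsC E)) (_≟ᶜ D)
              (λ (C∈ , w∈C) → C∈ , ∈-varsC (in-S′ C∈ w∈C)) (λ { refl → D∈ , v∈D })
              (λ { (C∈ , w∈C) refl → x∉D (in-S′ C∈ w∈C) }) F)
      in <⇒≱ fewer (v-min w∈Vs (w∉U , w∈S))
      where
      open Restriction b
      new? = newVar? S (map var U)
      new′? = newVar? S′ (v ∷ map var U)
      T? = λ w → new? w ×-dec (¬? (w ≟ v) ×-dec ¬? (new′? w))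
      N? = λ w → (w ≟ v) ⊎-dec new′? w

      cover : ∀ {w} → NewVar S (map var U) w → (w ≡ v ⊎ NewVar S′ (v ∷ map var U) w) ⊎
        (NewVar S (map var U) w × w ≢ v × ¬ NewVar S′ (v ∷ map var U) w)
      cover {w} new with w ≟ v | new′? w
      ... | yes w≡v | _        = inj₁ (inj₁ w≡v)
      ... | no _    | yes new′ = inj₁ (inj₂ new′)
      ... | no w≢v  | no ¬new′ = inj₂ (new , w≢v , ¬new′)

      S′⊆F : ∀ {E} → E ∈ S′ → E ∈ F
      S′⊆F = S⊆F ∘ proj₁ ∘ ∈-without⁻ (v , b) {S = S}

      -- The restriction loses at least two clauses, so by Tarsi's bound it loses at least two
      -- variables, and `v` is only one of them.
      remaining : E ≢ E′ → 1 ≤ count T? Vs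
      remaining E≢E′ = +-cancelˡ-≤ (2 + n′) 1 _ (begin
        2 + n′ + 1                         ≡⟨ +-comm (2 + n′) 1 ⟩
        2 + suc n′                         ≤⟨ +-mono-≤ two (size-bound F Vs Vs! crit′ S′⊆F D′∈) ⟩
        count X? F + size F S′      ≤⟨ count-disjoint (_∈ᶜ? S) X? (_∈ᶜ? S′) proj₁
                                                (proj₁ ∘ ∈-without⁻ (v , b) {S = S})
                                                (λ (_ , x∈) C∈ → proj₂ (∈-without⁻ (v , b) {S = S} C∈) x∈) F ⟩
        size F S                    ≡⟨ def ⟩
        suc (count new? Vs)                ≤⟨ s≤s (count-cover new? N? T? cover Vs) ⟩
        suc (count N? Vs + count T? Vs)    ≤⟨ s≤s (+-monoˡ-≤ _ (count-cover N? (_≟ v) new′? id Vs)) ⟩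
        suc (count (_≟ v) Vs + n′ + count T? Vs)
                                           ≤⟨ s≤s (+-monoˡ-≤ _ (+-monoˡ-≤ n′ (count-≡ _≟_ v Vs!))) ⟩
        2 + n′ + count T? Vs ∎)
        where
        open ≤-Reasoning
        n′ = count new′? Vs
        X? = λ C → (C ∈ᶜ? S) ×-dec ((v , b) ∈ᴸ? C)
        two = count-≥2 _≟ᶜ_ X? (S⊆F E∈) (S⊆F E′∈) (E∈ , x∈E) (E′∈ , x∈E′) E≢E′
        D′∈ = let _ , D∈ , x∉D , _ = opposite in ∈-without⁺ {x = v , b} D∈ x∉D

-- A literal x of D missing from C would let an assignment falsify C and satisfy x;
-- making y true then satisfies C and keeps D satisfied.
sibling-⊆ : ∀ {U S C D y} → Saturated U S → var y ∉ map var U → C ∈ S → D ∈ S → y ∈ C →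
  (∀ {E} → E ∈ S → neg y ∈ E → E ≡ D) → ∀ {x} → x ∈ D → x ≢ neg y → var x ∉ map var U → x ∈ C
sibling-⊆ {C = C} {D} {y} sat y∉U C∈ D∈ y∈C D-only {x} x∈D x≢ x∉U with x ∈ᴸ? C
... | yes x∈C = x∈C
... | no x∉C =
  let φ , sep , px = Saturated.saturate sat C∈ x∉C x∉U
  in ⊥-elim (Saturated.unsat sat (set φ y) (ext-set y y∉U (Separates.ext sep)) (All.tabulate λ {E} E∈ →
       case E ≟ᶜ C of λ
         { (yes refl) → lose y∈C (set-self φ y)
         ; (no E≢C) → case E ≟ᶜ D of λ
             { (yes refl) → lose x∈D (set-keep φ y px x≢)
             ; (no E≢D) → set-keep-clause φ y (Separates.others sep E∈ E≢C) (E≢D ∘ D-only E∈) } }))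

-- A true literal over a variable of `U` would itself belong to `U`, and critical clauses avoid `U`.
satisfied-new : ∀ {U S φ E x} → Critical U S → Ext U φ → E ∈ S → x ∈ E → satLit φ x → var x ∉ map var U
satisfied-new {φ = φ} {x = x} crit ext E∈ x∈E px v∈U with y@(v , b) , y∈U , refl ← ∈-map⁻ var v∈U =
  critical-∌ crit (subst (_∈ _) (cong (v ,_) (trans (sym (All.lookup ext y∈U)) px)) y∈U) E∈ x∈E

-- Pure literals and the contraction of a variable.

Pure : Lit → ClauseSet → Set
Pure x G = Any (x ∈_) G × All (neg x ∉_) G

pure? : ∀ G → Decidable (λ x → Pure x G)
pure? G x = any? (x ∈ᴸ?_) G ×-dec All.all? (λ E → ¬? (neg x ∈ᴸ? E)) G

-- The pure literals of G form the clause for which G is a minimal premise set.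
record TotalUnder (U : List Lit) (S : ClauseSet) : Set where
  field
    hitting : ∀ {E E′} → E ∈ S → E′ ∈ S → E ≢ E′ →
      ∃ λ x → x ∈ E × neg x ∈ E′ × var x ∉ map var U
    implied : ∀ {G E φ} → (∀ {E′} → E′ ∈ G → E′ ∈ S) → E ∈ G → Ext U φ → satCS φ G →
      ∃ λ x → Pure x G × satLit φ x × var x ∉ map var U

no-complement : ∀ {U S E} x → Critical U S → E ∈ S → x ∈ E → neg x ∉ E
no-complement x crit E∈ x∈ ¬x∈ with φ , sep ← Critical.separate crit E∈ with satLit? φ x
... | yes p = Separates.falsifies sep (lose x∈ p)
... | no ¬p = Separates.falsifies sep (lose ¬x∈ (¬satLit⇒neg φ x ¬p))

replace : Clause → Clause → Clause → Clause
replace D C E with E ≟ᶜ D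
... | yes _ = C
... | no _  = E

-- Setting v to false removes D and turns C into the resolvent of C and D.
module Contraction {U S} (sat : Saturated U S) {v} (v∉U : v ∉ map var U) {C D}
  (C∈ : C ∈ S) (D∈ : D ∈ S) (+v∈C : (v , true) ∈ C) (-v∈D : (v , false) ∈ D)
  (C-only : ∀ {E} → E ∈ S → (v , true) ∈ E → E ≡ C)
  (D-only : ∀ {E} → E ∈ S → (v , false) ∈ E → E ≡ D) where

  open Saturated sat

  U′ : List Lit
  U′ = (v , false) ∷ U

  S′ : ClauseSet
  S′ = without (v , false) S

  S′⊆S : ∀ {E} → E ∈ S′ → E ∈ S
  S′⊆S = proj₁ ∘ ∈-without⁻ (v , false) {S = S}

  C≢D : C ≢ D
  C≢D refl = no-complement (v , true) critical C∈ +v∈C -v∈D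

  C∈S′ : C ∈ S′
  C∈S′ = ∈-without⁺ C∈ (no-complement (v , true) critical C∈ +v∈C)

  ∈S′ : ∀ {E} → E ∈ S → E ≢ D → E ∈ S′
  ∈S′ E∈ E≢D = ∈-without⁺ E∈ (E≢D ∘ D-only E∈)

  D∉S′ : D ∉ S′
  D∉S′ D∈S′ = proj₂ (∈-without⁻ (v , false) {S = S} D∈S′) -v∈D

  ≢-new : ∀ {w} → w ∉ map var U′ → w ≢ v
  ≢-new w∉ refl = w∉ (here refl)

  new-∷ : ∀ {w} → w ∉ map var U → w ≢ v → w ∉ map var U′
  new-∷ w∉ w≢v (here w≡v)  = w≢v w≡v
  new-∷ w∉ w≢v (there w∈U) = w∉ w∈U

  D⊆C : ∀ {x} → x ∈ D → x ≢ (v , false) → var x ∉ map var U → x ∈ C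
  D⊆C = sibling-⊆ sat v∉U C∈ D∈ +v∈C D-only

  C⊆D : ∀ {x} → x ∈ C → x ≢ (v , true) → var x ∉ map var U → x ∈ D
  C⊆D = sibling-⊆ sat v∉U D∈ C∈ -v∈D C-only

  lower-C : ∀ {φ} → satClause φ C → φ v ≡ false → satClause (set φ (v , false)) C
  lower-C {φ} satC φv with x , x∈ , p ← find satC =
    lose x∈ (set-keep φ (v , false) p λ { refl → case trans (sym p) φv of λ () })

  -- A true literal of `D` is over neither `v` nor `U` here, so it also lies in `C` and survives the
  -- change at `v`.
  lower-D : ∀ {φ} → Ext U φ → satClause φ D → φ v ≡ true → satClause (set φ (v , false)) C
  lower-D {φ} ext satD φv with x , x∈ , p ← find satD =
    lose (D⊆C x∈ (λ { refl → case trans (sym p) φv of λ () }) (satisfied-new critical ext D∈ x∈ p))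
         (set-keep φ (v , false) p (λ { refl → C≢D (sym (C-only D∈ x∈)) }))

  lower-other : ∀ {φ E} → E ∈ S → E ≢ C → satClause φ E → satClause (set φ (v , false)) E
  lower-other {φ} E∈ E≢C s = set-keep-clause φ (v , false) s (E≢C ∘ C-only E∈)

  -- Of `C` and `D`, the one whose literal over `v` is false supplies the surviving true literal of
  -- `C`.
  lower-both : ∀ {φ} → Ext U φ → satClause φ C → satClause φ D → satClause (set φ (v , false)) C
  lower-both {φ} ext satC satD with φ v in φv
  ... | true  = lower-D ext satD φv
  ... | false = lower-C satC φv

  saturated′ : Saturated U′ S′
  saturated′ = record
    { critical = saturated-without-critical (v , false) sat v∉U
    ; saturate = saturate′ }
    where
    saturate′ : ∀ {E x} → E ∈ S′ → x ∉ E → var x ∉ map var U′ → ∃ λ φ → Separates U′ S′ E φ × satLit φ x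
    saturate′ {E} {x} E∈S′ x∉E x∉U′ with saturate (S′⊆S E∈S′) x∉E (x∉U′ ∘ there) | E ≟ᶜ C
    -- Falsifying `C` already forces `v` to be false, so the assignment needs no change.
    ... | φ , sep , px | yes refl = φ ,
          separates-∷ (¬satLit⇒neg φ (v , true) (λ p → Separates.falsifies sep (lose +v∈C p)))
            (separates-⊆ S′⊆S sep) , px
    ... | φ , sep , px | no E≢C = set φ (v , false) , record
          { ext       = set-self φ (v , false) ∷ ext-set (v , false) v∉U ext
          ; others    = others′
          ; falsifies = λ s → falsifies
              (set-only-clause φ (v , false) s (proj₂ (∈-without⁻ (v , false) {S = S} E∈S′))) }
          , set-keep φ (v , false) px (λ { refl → x∉U′ (here refl) })
      where
      open Separates sep
      others′ : ∀ {E′} → E′ ∈ S′ → E′ ≢ E → satClause (set φ (v , false)) E′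
      others′ {E′} E′∈ E′≢E with E′ ≟ᶜ C
      ... | no E′≢C  = lower-other (S′⊆S E′∈) E′≢C (others (S′⊆S E′∈) E′≢E)
      ... | yes refl = lower-both ext (others C∈ E′≢E) (others D∈ λ { refl → D∉S′ E∈S′ })

  -- Only `D` is dropped, and its new variables other than `v` occur in `C`.
  newVar-cover : ∀ {w} → NewVar S (map var U) w → w ≡ v ⊎ NewVar S′ (map var U′) w
  newVar-cover {w} (w∉U , w∈S) with w ≟ v
  ... | yes w≡v = inj₁ w≡v
  ... | no w≢v = let E , E∈ , w∈E = find w∈S in inj₂ (new-∷ w∉U w≢v , (case E ≟ᶜ D of λ
    { (yes refl) → let b , x∈D = varsC-∈ w∈E in
        lose C∈S′ (∈-varsC (D⊆C x∈D (w≢v ∘ cong var) w∉U))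
    ; (no E≢D) → lose (∈S′ E∈ E≢D) w∈E }))

  module _ (total′ : TotalUnder U′ S′) where

    open TotalUnder total′ renaming (hitting to hitting′; implied to implied′)

    hits-C : ∀ {E} → E ∈ S → E ≢ D → E ≢ C → ∃ λ x → x ∈ E × neg x ∈ D × var x ∉ map var U
    hits-C E∈ E≢D E≢C =
      let x , x∈ , ¬x∈ , x∉U′ = hitting′ (∈S′ E∈ E≢D) C∈S′ E≢C
      in x , x∈ , C⊆D ¬x∈ (≢-new x∉U′ ∘ cong var) (x∉U′ ∘ there) , x∉U′ ∘ there

    hitting : ∀ {E E′} → E ∈ S → E′ ∈ S → E ≢ E′ → ∃ λ x → x ∈ E × neg x ∈ E′ × var x ∉ map var U
    hitting {E} {E′} E∈ E′∈ E≢E′ with E ≟ᶜ D | E′ ≟ᶜ D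
    ... | yes refl | yes refl = ⊥-elim (E≢E′ refl)
    ... | no E≢D   | no E′≢D  =
      let x , x∈ , ¬x∈ , x∉ = hitting′ (∈S′ E∈ E≢D) (∈S′ E′∈ E′≢D) E≢E′ in x , x∈ , ¬x∈ , x∉ ∘ there
    ... | no E≢D   | yes refl = case E ≟ᶜ C of λ
      { (yes refl) → (v , true) , +v∈C , -v∈D , v∉U
      ; (no E≢C)   → hits-C E∈ E≢D E≢C }
    ... | yes refl | no E′≢D  = case E′ ≟ᶜ C of λ
      { (yes refl) → (v , false) , -v∈D , +v∈C , v∉U
      ; (no E′≢C)  → let x , x∈ , ¬x∈ , x∉ = hits-C E′∈ E′≢D E′≢C in
          neg x , ¬x∈ , subst (_∈ E′) (sym (neg-involutive x)) x∈ , x∉ }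

    -- Apply the hypothesis to G with D replaced by C, after setting v to false. If that breaks C,
    -- then only one of C and D belongs to G, and its literal over v is pure and true.
    implied : ∀ {G E φ} → (∀ {E′} → E′ ∈ G → E′ ∈ S) → E ∈ G → Ext U φ → satCS φ G →
      ∃ λ x → Pure x G × satLit φ x × var x ∉ map var U
    implied {G} {E} {φ} G⊆S E∈G ext satG with satCS? (set φ (v , false)) (map (replace D C) G)
    ... | yes satG′ =
      let x , (occ , ¬occ) , px , x∉U′ = implied′ G′⊆S′ (∈-map⁺ (replace D C) E∈G)
            (set-self φ (v , false) ∷ ext-set (v , false) v∉U ext) satG′
          x≢v = ≢-new x∉U′
      in x , ( (let E′ , E′∈ , x∈E′ = find occ
                    E₀ , E₀∈ , E′≡ = ∈-map⁻ (replace D C) E′∈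
                in lose E₀∈ (back {E₀} x≢v (x∉U′ ∘ there) (subst (x ∈_) E′≡ x∈E′)))
             , All.tabulate (λ {E₀} E₀∈ ¬x∈E₀ → All.lookup ¬occ (∈-map⁺ (replace D C) E₀∈)
                 (forth {E₀} x≢v (x∉U′ ∘ there) ¬x∈E₀)) )
           , set-only φ (v , false) px (x≢v ∘ cong var) , x∉U′ ∘ there
      where
      G′⊆S′ : ∀ {E′} → E′ ∈ map (replace D C) G → E′ ∈ S′
      G′⊆S′ E′∈ with E₀ , E₀∈ , refl ← ∈-map⁻ (replace D C) E′∈ with E₀ ≟ᶜ D
      ... | yes _   = C∈S′
      ... | no E₀≢D = ∈S′ (G⊆S E₀∈) E₀≢D

      back : ∀ {E₀ x} → var x ≢ v → var x ∉ map var U → x ∈ replace D C E₀ → x ∈ E₀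
      back {E₀} x≢v x∉U x∈ with E₀ ≟ᶜ D
      ... | yes refl = C⊆D x∈ (x≢v ∘ cong var) x∉U
      ... | no _     = x∈

      forth : ∀ {E₀ x} → var x ≢ v → var x ∉ map var U → x ∈ E₀ → x ∈ replace D C E₀
      forth {E₀} x≢v x∉U x∈ with E₀ ≟ᶜ D
      ... | yes refl = D⊆C x∈ (x≢v ∘ cong var) x∉U
      ... | no _     = x∈
    ... | no ¬satG′ = pure-v (φ v) refl
      where
      broken : (C ∈ G ⊎ D ∈ G) × ¬ satClause (set φ (v , false)) C
      broken with find (¬All⇒Any¬ (satClause? (set φ (v , false))) _ ¬satG′)
      ... | E′ , E′∈ , ¬sat with E₀ , E₀∈ , refl ← ∈-map⁻ (replace D C) E′∈ with E₀ ≟ᶜ D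
      ...   | yes refl = inj₂ E₀∈ , ¬sat
      ...   | no _ with E₀ ≟ᶜ C
      ...     | yes refl = inj₁ E₀∈ , ¬sat
      ...     | no E₀≢C = ⊥-elim (¬sat (lower-other (G⊆S E₀∈) E₀≢C (All.lookup satG E₀∈)))

      pure-v : ∀ b → φ v ≡ b → ∃ λ x → Pure x G × satLit φ x × var x ∉ map var U
      pure-v true φv = (v , true) , (lose C∈G +v∈C , All.tabulate λ E∈ x∈ →
          D∉G (subst (_∈ G) (D-only (G⊆S E∈) x∈) E∈)) , φv , v∉U
        where
        D∉G : D ∉ G
        D∉G D∈G = proj₂ broken (lower-D ext (All.lookup satG D∈G) φv)
        C∈G : C ∈ G
        C∈G = [ id , ⊥-elim ∘ D∉G ]′ (proj₁ broken)
      pure-v false φv = (v , false) , (lose D∈G -v∈D , All.tabulate λ E∈ x∈ →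
          C∉G (subst (_∈ G) (C-only (G⊆S E∈) x∈) E∈)) , φv , v∉U
        where
        C∉G : C ∉ G
        C∉G C∈G = proj₂ broken (lower-C (All.lookup satG C∈G) φv)
        D∈G : D ∈ G
        D∈G = [ ⊥-elim ∘ C∉G , id ]′ (proj₁ broken)

    total : TotalUnder U S
    total = record { hitting = hitting ; implied = implied }

-- Induction on the number of unassigned variables.

module _ (F : ClauseSet) (Vs : List Var) (Vs! : Unique Vs) where

  -- Deficiency one is carried along as `size F S ≡ suc n`. For `n` zero only one clause is left;
  -- otherwise a variable with the fewest occurrences is contracted.
  saturated⇒total : ∀ n {U S} → newVar-count Vs S (map var U) ≡ n → size F S ≡ suc n →
    (∀ {E} → E ∈ S → E ∈ F) → Saturated U S → TotalUnder U S
  saturated⇒total zero {U} {S} _ size≡1 S⊆F sat = record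
    { hitting = λ E∈ E′∈ E≢E′ → ⊥-elim (E≢E′ (one E∈ E′∈))
    ; implied = λ G⊆S E∈G ext satG → ⊥-elim (Saturated.unsat sat _ ext (All.tabulate λ E′∈ →
        subst (satClause _) (one (G⊆S E∈G) E′∈) (All.lookup satG E∈G))) }
    where
    one : ∀ {E E′} → E ∈ S → E′ ∈ S → E ≡ E′
    one {E} {E′} E∈ E′∈ = decidable-stable (E ≟ᶜ E′) λ E≢E′ →
      case ≤-trans (count-≥2 _≟ᶜ_ (_∈ᶜ? S) (S⊆F E∈) (S⊆F E′∈) E∈ E′∈ E≢E′) (≤-reflexive size≡1) of λ
        { (s≤s ()) }
  saturated⇒total (suc n) {U} {S} new≡ size≡ S⊆F sat
    with v₀ , v₀∈Vs , v₀-new ← count-∃ (newVar? S (map var U)) Vs (≤-trans (s≤s z≤n) (≤-reflexive (sym new≡)))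
    with v , v∈ , v-min ← minimal (occurrences F S) _ (∈-filter⁺ (newVar? S (map var U)) v₀∈Vs v₀-new)
    with v∈Vs , v∉U , v∈S ← ∈-filter⁻ (newVar? S (map var U)) {xs = Vs} v∈
    = total (saturated⇒total n new′≡ size′≡ (S⊆F ∘ S′⊆S) saturated′)
    where
    def : size F S ≡ suc (newVar-count Vs S (map var U))
    def = trans size≡ (cong suc (sym new≡))
    min = λ {w} w∈Vs w-new → v-min {w} (∈-filter⁺ (newVar? S (map var U)) w∈Vs w-new)
    once = occurs-once F Vs Vs! sat S⊆F def v∉U v∈S min
    C = negative-occurs F Vs Vs! sat S⊆F def v∉U v∈S min false
    D = negative-occurs F Vs Vs! sat S⊆F def v∉U v∈S min true
    C∈ = proj₁ (proj₂ C)
    D∈ = proj₁ (proj₂ D)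
    x∈C = proj₂ (proj₂ C)
    x∈D = proj₂ (proj₂ D)
    once-C = λ {E} E∈ x∈ → once true {E} E∈ C∈ x∈ x∈C
    once-D = λ {E} E∈ x∈ → once false {E} E∈ D∈ x∈ x∈D
    open Contraction sat v∉U C∈ D∈ x∈C x∈D
      once-C once-D

    new = newVar-count Vs S (map var U)
    new′ = newVar-count Vs S′ (map var U′)

    -- Contraction loses no variable but `v` and at least the clause `D`; Tarsi's bound then forces
    -- exactly one variable and one clause to be lost.
    lower : n ≤ new′
    lower = +-cancelˡ-≤ 1 _ _ (≤-trans (≤-reflexive (sym new≡)) (≤-trans
      (count-cover (newVar? S (map var U)) (_≟ v) (newVar? S′ (map var U′)) newVar-cover Vs)
      (+-monoˡ-≤ new′ (count-≡ _≟_ v Vs!))))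

    middle : suc new′ ≤ size F S′
    middle = size-bound F Vs Vs! (Saturated.critical saturated′) (S⊆F ∘ S′⊆S) C∈S′

    upper : size F S′ ≤ suc n
    upper = +-cancelˡ-≤ 1 _ _ (≤-trans
      (+-monoˡ-≤ (size F S′) (count-pos (_≟ᶜ proj₁ D) (S⊆F D∈) refl))
      (≤-trans
        (count-disjoint (_∈ᶜ? S) (_≟ᶜ proj₁ D) (_∈ᶜ? S′) (λ { refl → D∈ }) S′⊆S (λ { refl → D∉S′ }) F)
        (≤-reflexive size≡)))

    new′≡ : new′ ≡ n
    new′≡ = ≤-antisym (+-cancelˡ-≤ 1 _ _ (≤-trans middle upper)) lower

    size′≡ : size F S′ ≡ suc n
    size′≡ = ≤-antisym upper (≤-trans (s≤s lower) middle)

-- Falsifying a clause, and hitting clause-sets.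

falsify : Clause → Assignment → Assignment
falsify C ψ v with (v , true) ∈ᴸ? C | (v , false) ∈ᴸ? C
... | yes _ | _     = false
... | no _  | yes _ = true
... | no _  | no _  = ψ v

falsify-∈ : ∀ {C} ψ {x} → NoComplementary C → x ∈ C → satLit (falsify C ψ) (neg x)
falsify-∈ {C} ψ {v , b} nc x∈ with b | (v , true) ∈ᴸ? C | (v , false) ∈ᴸ? C
... | true  | yes _  | _      = refl
... | true  | no x∉  | _      = ⊥-elim (x∉ x∈)
... | false | yes x∈′ | _     = ⊥-elim (nc v (x∈′ , x∈))
... | false | no _   | yes _  = refl
... | false | no _   | no x∉  = ⊥-elim (x∉ x∈)

falsify-sat : ∀ {C} ψ {x} → satLit (falsify C ψ) x → neg x ∈ C ⊎ satLit ψ x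
falsify-sat {C} ψ {v , b} p with b | (v , true) ∈ᴸ? C | (v , false) ∈ᴸ? C
... | false | yes x∈ | _      = inj₁ x∈
... | true  | no _   | yes x∈ = inj₁ x∈
... | _     | no _   | no _   = inj₂ p

falsify-keep : ∀ {C} ψ {x} → satLit ψ x → x ∉ C → satLit (falsify C ψ) x
falsify-keep {C} ψ {v , b} p x∉ with b | (v , true) ∈ᴸ? C | (v , false) ∈ᴸ? C
... | true  | yes x∈ | _      = ⊥-elim (x∉ x∈)
... | false | yes _  | _      = refl
... | true  | no _   | yes _  = refl
... | false | no _   | yes x∈ = ⊥-elim (x∉ x∈)
... | _     | no _   | no _   = p

falsify-falsifies : ∀ {C} ψ → NoComplementary C → ¬ satClause (falsify C ψ) C
falsify-falsifies {C} ψ nc sat = let x , x∈ , p = find sat in satLit-neg (falsify C ψ) x p (falsify-∈ ψ nc x∈)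

Clash : Clause → Clause → Set
Clash E E′ = ∃ λ x → x ∈ E × neg x ∈ E′

clash-sym : ∀ {E E′} → Clash E E′ → Clash E′ E
clash-sym {E} (x , x∈ , ¬x∈) = neg x , ¬x∈ , subst (_∈ E) (sym (neg-involutive x)) x∈

falsify-clash : ∀ {E E′} ψ → NoComplementary E → Clash E E′ → satClause (falsify E ψ) E′
falsify-clash ψ nc (x , x∈ , ¬x∈) = lose ¬x∈ (falsify-∈ ψ nc x∈)

Hitting : ClauseSet → Set
Hitting F = ∀ {E E′} → E ∈ F → E′ ∈ F → E ≢ E′ → Clash E E′

allPairs-clash⇒hitting : ∀ {F} → AllPairs Clash F → Hitting F
allPairs-clash⇒hitting (c ∷ cs) (here refl) (here refl) E≢ = ⊥-elim (E≢ refl)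
allPairs-clash⇒hitting (c ∷ cs) (here refl) (there E′∈) E≢ = All.lookup c E′∈
allPairs-clash⇒hitting (c ∷ cs) (there E∈) (here refl) E≢ = clash-sym (All.lookup c E∈)
allPairs-clash⇒hitting (c ∷ cs) (there E∈) (there E′∈) E≢ = allPairs-clash⇒hitting cs E∈ E′∈ E≢

-- This falsifies all pure literals of `G` at once; the values at the remaining variables are
-- arbitrary.
antiPure : ClauseSet → Assignment
antiPure G v with any? ((v , true) ∈ᴸ?_) G
... | yes _ = false
... | no _  = true

antiPure-pure : ∀ {G x} → Pure x G → ¬ satLit (antiPure G) x
antiPure-pure {G} {v , b} (occ , ¬occ) p with b | any? ((v , true) ∈ᴸ?_) G
... | true  | no ¬o = ¬o occ
... | false | yes o = let E , E∈ , x∈ = find o in All.lookup ¬occ E∈ x∈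

-- The countermodel is found by searching for a model of `G` under the negated literals of `D`.
refute : ∀ {G D} → ¬ (G ⊨ D) → ∃ λ φ → satCS φ G × ¬ satClause φ D
refute {G} {D} ¬imp with satUnder? (map neg D) G
... | yes (φ , e , s) = φ , s , λ satD →
  let x , x∈ , p = find satD in satLit-neg φ x p (All.lookup e (∈-map⁺ neg x∈))
... | no ¬sat = ⊥-elim (¬imp λ φ s → decidable-stable (satClause? φ D) λ ¬satD →
  ¬sat (φ , All.tabulate (λ y∈ → case ∈-map⁻ neg y∈ of λ
    { (x , x∈ , refl) → ¬satLit⇒neg φ x (¬satD ∘ lose x∈) }) , s))

-- Consequences of being a minimal premise set.

remove-member : ∀ {A : Set} {x : A} {xs} → x ∈ xs →
  ∃ λ ys → (ys Sub.⊆ xs) × length ys < length xs × (∀ {y} → y ∈ xs → y ≡ x ⊎ y ∈ ys)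
remove-member {xs = x ∷ xs} (here refl) = xs , x Sub.∷ʳ Sub.⊆-refl , ≤-refl , λ
  { (here e) → inj₁ e ; (there y∈) → inj₂ y∈ }
remove-member {xs = x ∷ xs} (there x∈) = let ys , sub , lt , split = remove-member x∈ in
  x ∷ ys , refl Sub.∷ sub , s≤s lt , λ
  { (here e) → inj₂ (here e) ; (there y∈) → [ inj₁ , inj₂ ∘ there ]′ (split y∈) }

-- Minimality gives `φ` satisfying `E′` and `ψ` satisfying `E`, both falsifying `D`. If `x` in `E`
-- is true under `ψ` and does not clash with `E′`, making `x` true in `φ` satisfies both clauses but
-- not `D`.
mps-clash : ∀ {E E′} → IsMPS (E ∷ E′ ∷ []) → Clash E E′
mps-clash {E} {E′} (D , _ , imp , min)
  with φ , (φE′ ∷ []) , ¬φD ← refute (min (E′ ∷ []) (E Sub.∷ʳ Sub.⊆-refl) ≤-refl)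
  with ψ , (ψE ∷ []) , ¬ψD ← refute (min (E ∷ []) (refl Sub.∷ (E′ Sub.∷ʳ Sub.[])) ≤-refl)
  with x , x∈E , ψx ← find ψE
  with neg x ∈ᴸ? E′
... | yes ¬x∈E′ = x , x∈E , ¬x∈E′
... | no ¬x∉E′ = ⊥-elim (¬φD (set-only-clause φ x
        (imp _ (lose x∈E (set-self φ x) ∷ set-keep-clause φ x φE′ ¬x∉E′ ∷ []))
        (λ x∈D → ¬ψD (lose x∈D ψx))))

-- The literals of the implied clause D that do not occur in G may be falsified for free.
mps-implied : ∀ {G} → IsMPS G → ∀ {φ} → satCS φ G → ∃ λ x → Pure x G × satLit φ x
mps-implied {G} (D , (_ , nc) , imp , min) {φ} satG =
  let x , x∈D , px = find (imp φ′ (All.tabulate keep))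
  in x , (occ x∈D px , All.tabulate λ E∈ → no-clash E∈ x∈D) , φ-sat x∈D px
  where
  D₀ = filter (λ x → ¬? (any? (x ∈ᴸ?_) G)) D
  D₀⇒D : ∀ {y} → y ∈ D₀ → y ∈ D × ¬ Any (y ∈_) G
  D₀⇒D = ∈-filter⁻ (λ x → ¬? (any? (x ∈ᴸ?_) G)) {xs = D}
  φ′ = falsify D₀ φ

  keep : ∀ {E} → E ∈ G → satClause φ′ E
  keep E∈ = let y , y∈ , py = find (All.lookup satG E∈) in
    lose y∈ (falsify-keep φ py λ y∈D₀ → proj₂ (D₀⇒D y∈D₀) (lose E∈ y∈))

  not-both : ∀ {x} → x ∈ D → neg x ∉ D
  not-both {v , true}  x∈ ¬x∈ = nc v (x∈ , ¬x∈)
  not-both {v , false} x∈ ¬x∈ = nc v (¬x∈ , x∈)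

  φ-sat : ∀ {x} → x ∈ D → satLit φ′ x → satLit φ x
  φ-sat x∈ p = [ ⊥-elim ∘ not-both x∈ ∘ proj₁ ∘ D₀⇒D , id ]′ (falsify-sat φ p)

  occ : ∀ {x} → x ∈ D → satLit φ′ x → Any (x ∈_) G
  occ {x} x∈ p = decidable-stable (any? (x ∈ᴸ?_) G) λ ¬occ →
    satLit-neg φ′ x p (falsify-∈ φ (λ v (a , b) → nc v (proj₁ (D₀⇒D a) , proj₁ (D₀⇒D b)))
      (∈-filter⁺ (λ x → ¬? (any? (x ∈ᴸ?_) G)) x∈ ¬occ))

  -- A model of the other clauses falsifying `D` would make the complement of `x` true and so
  -- satisfy `E` as well, against `G ⊨ D`.
  no-clash : ∀ {E x} → E ∈ G → x ∈ D → neg x ∉ E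
  no-clash {x = x} E∈ x∈D ¬x∈E
    with G′ , sub , lt , split ← remove-member E∈
    with ψ , satG′ , ¬satD ← refute (min G′ sub lt)
    = ¬satD (imp ψ (All.tabulate λ E′∈ → case split E′∈ of λ
        { (inj₁ refl) → lose ¬x∈E (¬satLit⇒neg ψ x (¬satD ∘ lose x∈D))
        ; (inj₂ E′∈G′) → All.lookup satG′ E′∈G′ }))

-- Mixed variables and the upper bound on the number of clauses.

Mixed : ClauseSet → Var → Set
Mixed G v = Any ((v , true) ∈_) G × Any ((v , false) ∈_) G

mixed? : ∀ G → Decidable (Mixed G)
mixed? G v = any? ((v , true) ∈ᴸ?_) G ×-dec any? ((v , false) ∈ᴸ?_) G

-- A clause C hit by all of G turns a pure literal of G into a mixed variable: otherwise falsify C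
-- and all pure literals of G.
new-mixed : ∀ {C G} → NoComplementary C → All (Clash C) G → IsMPS G →
  ∃ λ x → Pure x G × neg x ∈ C
new-mixed {C} {G} nc hits mps =
  let x , pure , px = mps-implied mps (All.map (falsify-clash (antiPure G) nc) hits)
  in x , pure , [ id , ⊥-elim ∘ antiPure-pure pure ]′ (falsify-sat (antiPure G) px)

SubsetsMPS : ClauseSet → Set
SubsetsMPS F = ∀ G → G Sub.⊆ F → ¬ (G ≡ []) → IsMPS G

subsets-tail : ∀ {C F} → SubsetsMPS (C ∷ F) → SubsetsMPS F
subsets-tail {C} total G sub = total G (C Sub.∷ʳ sub)

head-clashes : ∀ {C F} → SubsetsMPS (C ∷ F) → All (Clash C) F
head-clashes {C} total = All.tabulate λ {E} E∈ →
  mps-clash (total (C ∷ E ∷ []) (refl Sub.∷ Sub.from∈ E∈) λ ())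

subsetsMPS⇒clash : ∀ F → SubsetsMPS F → AllPairs Clash F
subsetsMPS⇒clash []      total = []
subsetsMPS⇒clash (C ∷ F) total = head-clashes total ∷ subsetsMPS⇒clash F (subsets-tail total)

mixed-grows : ∀ {Vs C G x} → var x ∈ Vs → Pure x G → neg x ∈ C →
  suc (count (mixed? G) Vs) ≤ count (mixed? (C ∷ G)) Vs
mixed-grows {Vs} {C} {G} {x} x∈Vs (occ , ¬occ) ¬x∈C = ≤-trans
  (+-monoˡ-≤ (count (mixed? G) Vs) (count-pos (_≟ var x) x∈Vs refl))
  (count-disjoint (mixed? (C ∷ G)) (_≟ var x) (mixed? G) (λ { refl → mixed x occ ¬x∈C })
    (λ (p , n) → there p , there n) (λ { refl → unmixed x ¬occ }) Vs)
  where
  mixed : ∀ x → Any (x ∈_) G → neg x ∈ C → Mixed (C ∷ G) (var x)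
  mixed (v , true)  occ ¬x∈ = there occ , here ¬x∈
  mixed (v , false) occ ¬x∈ = here ¬x∈ , there occ

  unmixed : ∀ x → All (neg x ∉_) G → ¬ Mixed G (var x)
  unmixed (v , true)  ¬occ (_ , n) = let E , E∈ , x∈ = find n in All.lookup ¬occ E∈ x∈
  unmixed (v , false) ¬occ (p , _) = let E , E∈ , x∈ = find p in All.lookup ¬occ E∈ x∈

-- Built up from its end, the list gains a mixed variable with every clause put in front; the last
-- clause accounts for the `suc`.
length≤mixed : ∀ Vs C F → (∀ {x} → Any (x ∈_) (C ∷ F) → var x ∈ Vs) → All IsClause (C ∷ F) →
  SubsetsMPS (C ∷ F) → length (C ∷ F) ≤ suc (count (mixed? (C ∷ F)) Vs)
length≤mixed Vs C []       vars∈ cl total = s≤s z≤n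
length≤mixed Vs C (C′ ∷ F) vars∈ ((_ , nc) ∷ cl) total =
  let x , pure , ¬x∈C = new-mixed nc (head-clashes total) (total (C′ ∷ F) (C Sub.∷ʳ Sub.⊆-refl) λ ())
  in s≤s (≤-trans (length≤mixed Vs C′ F (λ {x} → vars∈ {x} ∘ there) cl (subsets-tail total))
                  (mixed-grows {x = x} (vars∈ {x} (there (proj₁ pure))) pure ¬x∈C))

-- From total mps to SMU of deficiency one.

vars-∈ : ∀ {v E F} → E ∈ F → v ∈ varsC E → v ∈ vars F
vars-∈ E∈ v∈ = ∈-deduplicate⁺ _≟_ (∈-allVars E∈ v∈)

vars-∃ : ∀ {v} F → v ∈ vars F → Any (λ E → v ∈ varsC E) F
vars-∃ F v∈ = ∈-concatMap⁻ varsC (∈-deduplicate⁻ _≟_ (allVars F) v∈)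

vars-! : ∀ F → Unique (vars F)
vars-! F = deduplicate-! _≟_ (allVars F)

newVar-count-all : ∀ F → newVar-count (vars F) F [] ≡ length (vars F)
newVar-count-all F = cong length (filter-all (newVar? F []) (All.tabulate λ v∈ → (λ ()) , vars-∃ F v∈))

size-all : ∀ F → size F F ≡ length F
size-all F = cong length (filter-all (_∈ᶜ? F) (All.tabulate id))

distinct⇒unique : ∀ {F} → AllPairs (λ C D → ¬ (C ≐ D)) F → Unique F
distinct⇒unique = AllPairs.map λ ≢ → λ { refl → ≢ (id , id) }

∈-removeAt : ∀ {A : Set} (xs : List A) i {y} → y ∈ xs → y ≢ lookup xs i → y ∈ removeAt xs i
∈-removeAt (x ∷ xs) zero    (here refl) y≢ = ⊥-elim (y≢ refl)
∈-removeAt (x ∷ xs) zero    (there y∈)  y≢ = y∈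
∈-removeAt (x ∷ xs) (suc i) (here refl) y≢ = here refl
∈-removeAt (x ∷ xs) (suc i) (there y∈)  y≢ = there (∈-removeAt xs i y∈ y≢)

removeAt-∈ : ∀ {A : Set} {xs : List A} i → Unique xs → ∀ {y} → y ∈ removeAt xs i → y ∈ xs × y ≢ lookup xs i
removeAt-∈ {xs = x ∷ xs} zero    (x∉ ∷ u) y∈          = there y∈ , λ { refl → All.lookup x∉ y∈ refl }
removeAt-∈ {xs = x ∷ xs} (suc i) (x∉ ∷ u) (here refl) = here refl , λ { refl → All.lookup x∉ (∈-lookup i) refl }
removeAt-∈ {xs = x ∷ xs} (suc i) (x∉ ∷ u) (there y∈)  = let y∈xs , y≢ = removeAt-∈ i u y∈ in there y∈xs , y≢

module _ {A : Set} {P : Pred A 0ℓ} where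

  All-updateAt⁺ : ∀ {xs} i {f} → P (f (lookup xs i)) → All P (removeAt xs i) → All P (updateAt xs i f)
  All-updateAt⁺ {x ∷ xs} zero    p ps       = p ∷ ps
  All-updateAt⁺ {x ∷ xs} (suc i) p (q ∷ ps) = q ∷ All-updateAt⁺ i p ps

  All-updateAt⁻ : ∀ {xs} i {f} → All P (updateAt xs i f) → P (f (lookup xs i)) × All P (removeAt xs i)
  All-updateAt⁻ {x ∷ xs} zero    (p ∷ ps) = p , ps
  All-updateAt⁻ {x ∷ xs} (suc i) (q ∷ ps) = let p , ps′ = All-updateAt⁻ i ps in p , q ∷ ps′

total⇒SMUδ1 : ∀ F → IsClauseSet F → Unsatisfiable F → IsTotalMPS F → IsSMUδ1 F
total⇒SMUδ1 [] _ _ (nonempty , _) = ⊥-elim (nonempty refl)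
total⇒SMUδ1 F@(C ∷ F₀) (clauses , distinct) unsat (_ , total) = ((unsat , sat-remove) , sat-extend) , deficiency
  where
  hits : Hitting F
  hits = allPairs-clash⇒hitting (subsetsMPS⇒clash F total)

  noComp : ∀ {E} → E ∈ F → NoComplementary E
  noComp E∈ = proj₂ (All.lookup clauses E∈)

  falsify-others : ∀ {E} ψ → E ∈ F → ∀ {E′} → E′ ∈ F → E′ ≢ E → satClause (falsify E ψ) E′
  falsify-others ψ E∈ E′∈ E′≢E = falsify-clash ψ (noComp E∈) (hits E∈ E′∈ (E′≢E ∘ sym))

  falsify-removeAt : ∀ ψ i → satCS (falsify (lookup F i) ψ) (removeAt F i)
  falsify-removeAt ψ i = All.tabulate λ E∈ →
    let E∈F , E≢ = removeAt-∈ i (distinct⇒unique distinct) E∈ in falsify-others ψ (∈-lookup i) E∈F E≢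

  sat-remove : ∀ i → Satisfiable (removeAt F i)
  sat-remove i = _ , falsify-removeAt (λ _ → true) i

  sat-extend : ∀ i x → var x ∉ varsC (lookup F i) → Satisfiable (updateAt F i (x ∷_))
  -- Off the clause the assignment is constantly `b`, so it makes `x` true while falsifying the
  -- clause.
  sat-extend i x@(v , b) v∉ = _ , All-updateAt⁺ i
    (here (falsify-keep {lookup F i} (λ _ → b) {x} refl (v∉ ∘ ∈-varsC))) (falsify-removeAt (λ _ → b) i)

  critical : Critical [] F
  critical = record
    { unsat    = λ φ _ s → unsat (φ , s)
    ; separate = λ {E} E∈ → falsify E (λ _ → true) , record
        { ext       = []
        ; others    = falsify-others _ E∈
        ; falsifies = falsify-falsifies _ (noComp E∈) } }

  deficiency : Deficiency1 F
  deficiency = ≤-antisym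
    (≤-trans (length≤mixed (vars F) C F₀ (λ o → let E , E∈ , x∈ = find o in vars-∈ E∈ (∈-varsC x∈)) clauses total)
             (s≤s (length-filter (mixed? F) (vars F))))
    (≤-trans (≤-reflexive (cong suc (sym (newVar-count-all F))))
             (≤-trans (size-bound F (vars F) (vars-! F) critical id (here refl)) (≤-reflexive (size-all F))))

-- From SMU of deficiency one to total mps.

SMU⇒saturated : ∀ F → IsSMU F → Saturated [] F
SMU⇒saturated F ((unsat , sat-remove) , sat-extend) = record
  { critical = record { unsat = unsat′ ; separate = separate }
  ; saturate = saturate }
  where
  unsat′ : UnsatUnder [] F
  unsat′ φ _ s = unsat (φ , s)

  separates : ∀ i {φ} → satCS φ (removeAt F i) → Separates [] F (lookup F i) φ
  separates i s = record { ext = [] ; others = others ; falsifies = unsat⇒falsifies unsat′ [] others }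
    where others = λ {E} E∈ E≢ → All.lookup s (∈-removeAt F i {E} E∈ E≢)

  separate : ∀ {E} → E ∈ F → ∃ (Separates [] F E)
  separate {E} E∈ = let φ , s = sat-remove (Any.index E∈) in
    φ , subst (λ E → Separates [] F E φ) (sym (lookup-index E∈)) (separates (Any.index E∈) s)

  saturate : ∀ {E x} → E ∈ F → x ∉ E → var x ∉ [] → ∃ λ φ → Separates [] F E φ × satLit φ x
  saturate {E} {x} E∈ x∉ _ with var x ∈ⱽ? varsC E
  -- Here the complement of `x` lies in `E`, so falsifying `E` makes `x` true.
  ... | yes v∈ =
    let φ , sep = separate E∈ in φ , sep ,
      decidable-stable (satLit? φ x) (λ ¬px → Separates.falsifies sep
        (lose (neg-∈ v∈ x∉) (¬satLit⇒neg φ x ¬px)))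
  ... | no v∉ =
    let φ , s = sat-extend i x (subst (λ E → var x ∉ varsC E) E≡ v∉)
        sat-x , s′ = All-updateAt⁻ i s
        sep = separates i s′
    -- Since `E` is falsified, the extended clause can be satisfied only through `x`.
    in φ , subst (λ E → Separates [] F E φ) (sym E≡) sep , (case sat-x of λ
         { (here px) → px ; (there sat) → ⊥-elim (Separates.falsifies sep sat) })
    where
    i = Any.index E∈
    E≡ = lookup-index E∈

Unique-resp-⊆ : ∀ {A : Set} {xs ys : List A} → xs Sub.⊆ ys → Unique ys → Unique xs
Unique-resp-⊆ Sub.[]           []       = []
Unique-resp-⊆ (y Sub.∷ʳ sub)   (_ ∷ u)  = Unique-resp-⊆ sub u
Unique-resp-⊆ (refl Sub.∷ sub) (y∉ ∷ u) = All-resp-⊆ sub y∉ ∷ Unique-resp-⊆ sub u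

missing : ∀ {A : Set} {xs ys : List A} → xs Sub.⊆ ys → length xs < length ys → Unique ys →
  ∃ λ y → y ∈ ys × y ∉ xs
missing (y Sub.∷ʳ sub) _ (y∉ ∷ _) = y , here refl , λ y∈ → All.lookup y∉ (Sub.lookup sub y∈) refl
missing (refl Sub.∷ sub) (s≤s lt) (x∉ ∷ u) =
  let y , y∈ , y∉ = missing sub lt u in
  y , there y∈ , λ { (here refl) → All.lookup x∉ y∈ refl ; (there y∈xs) → y∉ y∈xs }

totalUnder⇒totalMPS : ∀ F → IsClauseSet F → F ≢ [] → TotalUnder [] F → IsTotalMPS F
totalUnder⇒totalMPS F (clauses , distinct) F≢[] total = F≢[] , λ
  { [] _ G≢[] → ⊥-elim (G≢[] refl) ; (E ∷ G) sub _ → mps (E ∷ G) sub (here refl) }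
  where
  open TotalUnder total

  mps : ∀ G → G Sub.⊆ F → ∀ {E} → E ∈ G → IsMPS G
  mps G sub E∈ = D , (filter⁺ (pure? G) (deduplicate-! _≟ᴸ_ (concat G)) , noComp) , implies , minimality
    where
    D = filter (pure? G) (deduplicate _≟ᴸ_ (concat G))

    D-pure : ∀ {x} → x ∈ D → Pure x G
    D-pure = proj₂ ∘ ∈-filter⁻ (pure? G) {xs = deduplicate _≟ᴸ_ (concat G)}

    noComp : NoComplementary D
    noComp v (x∈ , ¬x∈) =
      let E , E∈ , x∈E = find (proj₁ (D-pure x∈)) in All.lookup (proj₂ (D-pure ¬x∈)) E∈ x∈E

    implies : G ⊨ D
    implies φ satG =
      let x , pure , px , _ = implied (Sub.lookup sub) E∈ [] satG
          E , E∈ , x∈E = find (proj₁ pure)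
      in lose (∈-filter⁺ (pure? G) (∈-deduplicate⁺ _≟ᴸ_ (∈-concat⁺′ x∈E E∈)) pure) px

    -- Falsify a clause `E` missing from `G′` and, off `E`, all pure literals of `G`. Clashes with
    -- `E` satisfy `G′`, while a true literal of `D` would have its complement in `E`, against
    -- purity.
    minimality : ∀ G′ → G′ Sub.⊆ G → length G′ < length G → ¬ (G′ ⊨ D)
    minimality G′ sub′ lt imp =
      let E , E∈G , E∉G′ = missing sub′ lt (Unique-resp-⊆ sub (distinct⇒unique distinct))
          E∈F = Sub.lookup sub E∈G
          nc = proj₂ (All.lookup clauses E∈F)
          x , x∈D , px = find (imp (falsify E (antiPure G)) (All.tabulate λ E′∈ →
            let y , y∈ , ¬y∈ , _ = hitting E∈F (Sub.lookup sub (Sub.lookup sub′ E′∈)) (∈∉⇒≢ E′∈ E∉G′ ∘ sym)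
            in falsify-clash (antiPure G) nc (y , y∈ , ¬y∈)))
      in case falsify-sat (antiPure G) px of λ
           { (inj₁ ¬x∈E) → All.lookup (proj₂ (D-pure x∈D)) E∈G ¬x∈E
           ; (inj₂ qx) → antiPure-pure (D-pure x∈D) qx }

SMUδ1⇒total : ∀ F → IsClauseSet F → Unsatisfiable F → IsSMUδ1 F → IsTotalMPS F
SMUδ1⇒total F cs unsat (smu , deficiency) = totalUnder⇒totalMPS F cs (λ { refl → unsat ((λ _ → true) , []) })
  (saturated⇒total F (vars F) (vars-! F) (length (vars F)) (newVar-count-all F)
    (trans (size-all F) deficiency) id (SMU⇒saturated F smu))

theorem5p12 : ∀ (F : ClauseSet) → IsClauseSet F → Unsatisfiable F →
    (IsTotalMPS F → IsSMUδ1 F) × (IsSMUδ1 F → IsTotalMPS F)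
theorem5p12 F cs unsat = total⇒SMUδ1 F cs unsat , SMUδ1⇒total F cs unsat
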